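{- A Sudoku grid has a unique solution if and only if it has a logically deducible solution.
   Context: A Sudoku proposition is a formal symbol $r_ic_j \not\approx d$ with $i,j,d\in\{1,\dots,9\}$. Sudoku formulas are built inductively from Sudoku propositions and the constants $\top,\bot$ using $\lnot,\land,\lor,\Rightarrow,\Leftrightarrow$. A grid is a $9\times 9$ matrix $\mathcal{A}=[A_{ij}]_{9\times 9}$ of nonempty subsets $A_{ij}\subseteq\{1,\dots,9\}$; it is full if $|A_{ij}|=1$ for all $i,j$. Satisfaction $\mathcal{A}\models\phi$: $\mathcal{A}\models\top$ always, $\mathcal{A}\models\bot$ never, $\mathcal{A}\models r_ic_j\not\approx d$ iff $d\notin A_{ij}$, and the connectives are interpreted classically. Write $r_ic_j\equiv d$ for $\bigwedge_{s\ne d} r_ic_j\not\approx s$, and $r_ic_j\parallel r_\ell c_m$ for $\bigwedge_{1\le d\le 9}((r_ic_j\equiv d\Rightarrow r_\ell c_m\not\approx d)\land(r_\ell c_m\equiv d\Rightarrow r_ic_j\not\approx d))$. The set $\Sigma_{ax}$ consists of 27 formulas, one for each row, each column and each of the nine standard $3\times 3$ boxes: the conjunction of $r_ic_j\parallel r_\ell c_m$ over all pairs of distinct cells in that row, column or box. A Sudoku grid is a grid $\mathcal{A}$ with $\mathcal{A}\models\phi$ for all $\phi\in\Sigma_{ax}$ (i.e. whenever $A_{ij}=\{d\}$, $d$ belongs to no $A_{\ell m}$ for another cell in the same row, column or box). A full Sudoku grid is a Sudoku grid that is full. A solution of a Sudoku grid $\mathcal{A}=[A_{ij}]$ is a full Sudoku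 grid $\mathcal{S}=[S_{ij}]$ with $S_{ij}\subseteq A_{ij}$ for all $i,j$. A Sudoku axiom is a Sudoku formula that holds in every full Sudoku grid; $\Delta_{ax}$ is the set of all Sudoku axioms. For a set $\Phi$ of Sudoku formulas and a Sudoku formula $\alpha$, $\Phi\vdash\alpha$ means there is a finite sequence $\phi_1,\dots,\phi_n=\alpha$ of Sudoku formulas such that each $\phi_i$ is in $\Delta_{ax}$, or in $\Phi$, or is obtained by modus ponens from earlier formulas (there are $p,q<i$ with $\phi_q$ equal to $\phi_p\Rightarrow\phi_i$). $\Phi\vdash\Psi$ means $\Phi\vdash\alpha$ for all $\alpha\in\Psi$. For a Sudoku grid $\mathcal{A}$ let $\mathrm{Prop}(\mathcal{A})=\{r_ic_j\not\approx d: 1\le i,j,d\le 9,\ d\notin A_{ij}\}$. A solution $\mathcal{S}$ of $\mathcal{A}$ is a logically deducible solution of $\mathcal{A}$ if $\mathrm{Prop}(\mathcal{A})\vdash\mathrm{Prop}(\mathcal{S})$. -}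

module Defs where

open import Level using (0ℓ)
open import Data.Empty using (⊥)
open import Data.Fin using (Fin; combine; fromℕ; _<_; _≟_)
open import Data.Fin.Subset using (Subset; Nonempty; ∣_∣; _⊆_; _∉_)
open import Data.Fin.Subset.Properties using (_∈?_)
open import Data.List using (List; []; _∷_; _++_; map; foldr; filter; allFin; cartesianProduct; cartesianProductWith)
open import Data.List.Relation.Unary.All using (All)
open import Data.Nat using (ℕ; suc)
open import Data.Product using (_×_; _,_; proj₁; proj₂; ∃; ∃₂; uncurry)
open import Data.Product.Properties using (≡-dec)
open import Data.Sum using (_⊎_)
open import Data.Unit using (⊤)
open import Relation.Binary.PropositionalEquality using (_≡_)
open import Relation.Nullary using (Dec; yes; no; ¬_; ¬?)
open import Relation.Nullary.Decidable using (_×-dec_; _⊎-dec_; _→-dec_)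
open import Relation.Unary using (Pred; _∈_)

-- Rows, columns and digits 1, …, 9 are represented by Fin 9, i.e. by 0, …, 8.

Cell : Set
Cell = Fin 9 × Fin 9

infix  9 _≉_
infix  8 ~_
infixr 7 _∧_
infixr 6 _∨_
infixr 5 _⇒_
infix  4 _⇔_

data Formula : Set where
  _≉_         : Cell → Fin 9 → Formula
  true false  : Formula
  ~_          : Formula → Formula
  _∧_ _∨_     : Formula → Formula → Formula
  _⇒_ _⇔_     : Formula → Formula → Formula

record Grid : Set where
  field
    entry    : Fin 9 → Fin 9 → Subset 9
    nonempty : ∀ i j → Nonempty (entry i j)

open Grid public

-- Grids are compared by their entries only: the nonemptiness witnesses are
-- not part of the data.
_≈_ : Grid → Grid → Set
A ≈ B = ∀ i j → entry A i j ≡ entry B i j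

Full : Pred Grid 0ℓ
Full A = ∀ i j → ∣ entry A i j ∣ ≡ 1

-- Membership in a Subset is decidable, so satisfaction is decidable (see ⊨?)
-- and the constructive reading of the connectives is the classical one.
infix 3 _⊨_
_⊨_ : Grid → Formula → Set
A ⊨ (i , j) ≉ d = d ∉ entry A i j
A ⊨ true        = ⊤
A ⊨ false       = ⊥
A ⊨ ~ φ         = ¬ (A ⊨ φ)
A ⊨ φ ∧ ψ       = (A ⊨ φ) × (A ⊨ ψ)
A ⊨ φ ∨ ψ       = (A ⊨ φ) ⊎ (A ⊨ ψ)
A ⊨ φ ⇒ ψ       = (A ⊨ φ) → (A ⊨ ψ)
A ⊨ φ ⇔ ψ       = ((A ⊨ φ) → (A ⊨ ψ)) × ((A ⊨ ψ) → (A ⊨ φ))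

⊨? : ∀ A φ → Dec (A ⊨ φ)
⊨? A ((i , j) ≉ d) = ¬? (d ∈? entry A i j)
⊨? A true          = yes _
⊨? A false         = no λ ()
⊨? A (~ φ)         = ¬? (⊨? A φ)
⊨? A (φ ∧ ψ)       = ⊨? A φ ×-dec ⊨? A ψ
⊨? A (φ ∨ ψ)       = ⊨? A φ ⊎-dec ⊨? A ψ
⊨? A (φ ⇒ ψ)       = ⊨? A φ →-dec ⊨? A ψ
⊨? A (φ ⇔ ψ)       = (⊨? A φ →-dec ⊨? A ψ) ×-dec (⊨? A ψ →-dec ⊨? A φ)

⋀ : List Formula → Formula
⋀ = foldr _∧_ true

infix 9 _≐_ _∥_

-- x ≐ d is the formula written "x ≡ d" mathematically.
_≐_ : Cell → Fin 9 → Formula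
x ≐ d = ⋀ (map (x ≉_) (filter (λ s → ¬? (s ≟ d)) (allFin 9)))

_∥_ : Cell → Cell → Formula
x ∥ y = ⋀ (map (λ d → (x ≐ d ⇒ y ≉ d) ∧ (y ≐ d ⇒ x ≉ d)) (allFin 9))

row column : Fin 9 → List Cell
row    i = map (λ j → i , j) (allFin 9)
column j = map (λ i → i , j) (allFin 9)

-- combine b k is 3 * b + k, so box a b consists of the cells in the a-th band
-- of three rows and the b-th stack of three columns.
box : Fin 3 → Fin 3 → List Cell
box a b = cartesianProductWith (λ k l → combine a k , combine b l) (allFin 3) (allFin 3)

units : List (List Cell)
units = map row (allFin 9) ++ map column (allFin 9) ++ cartesianProductWith box (allFin 3) (allFin 3)

-- The pairs are ordered, so both x ∥ y and y ∥ x occur.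
unitAxiom : List Cell → Formula
unitAxiom xs = ⋀ (map (uncurry _∥_) (filter (λ p → ¬? (≡-dec _≟_ _≟_ (proj₁ p) (proj₂ p))) (cartesianProduct xs xs)))

Σax : List Formula
Σax = map unitAxiom units

IsSudoku : Pred Grid 0ℓ
IsSudoku A = All (A ⊨_) Σax

IsFullSudoku : Pred Grid 0ℓ
IsFullSudoku A = IsSudoku A × Full A

IsSolution : Grid → Pred Grid 0ℓ
IsSolution A S = IsFullSudoku S × (∀ i j → entry S i j ⊆ entry A i j)

Δax : Pred Formula 0ℓ
Δax φ = ∀ A → IsFullSudoku A → A ⊨ φ

infix 3 _⊢_ _⊢ˢ_

record _⊢_ (Φ : Pred Formula 0ℓ) (α : Formula) : Set where
  field
    n         : ℕ
    φ         : Fin (suc n) → Formula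
    ends      : φ (fromℕ n) ≡ α
    justified : ∀ i → φ i ∈ Δax ⊎ φ i ∈ Φ ⊎
                      ∃₂ λ p q → p < i × q < i × φ q ≡ (φ p ⇒ φ i)

_⊢ˢ_ : Pred Formula 0ℓ → Pred Formula 0ℓ → Set
Φ ⊢ˢ Ψ = ∀ α → α ∈ Ψ → Φ ⊢ α

Prop[_] : Grid → Pred Formula 0ℓ
Prop[ A ] φ = ∃ λ i → ∃₂ λ j d → d ∉ entry A i j × φ ≡ (i , j) ≉ d

IsDeducibleSolution : Grid → Pred Grid 0ℓ
IsDeducibleSolution A S = IsSolution A S × Prop[ A ] ⊢ˢ Prop[ S ]

{-# OPTIONS --safe #-}
module Submission where

-- The full Sudoku grids satisfying Prop(A) are exactly the solutions of A. So if
-- S is the unique solution and φ ∈ Prop(S), then π₁ ⇒ ⋯ ⇒ πₖ ⇒ φ, where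
-- Prop(A) = {π₁, …, πₖ}, holds in every full Sudoku grid; it is thus an axiom,
-- and k applications of modus ponens give φ. Conversely, by soundness every
-- solution T satisfies Prop(S), i.e. T ⊆ S, and T = S as both are full.

open import Level using (0ℓ)
open import Data.Fin using (Fin; fromℕ; inject₁; _<_)
open import Data.Fin.Induction using (<-wellFounded)
open import Data.Fin.Properties using (toℕ-inject₁; toℕ-fromℕ; toℕ<n)
open import Data.Fin.Relation.Unary.Top using (view; ‵fromℕ; ‵inject₁; view-fromℕ; view-inject₁)
open import Data.Fin.Subset using (Subset; ∣_∣; _⊆_; _∉_)
open import Data.Fin.Subset.Properties using (_∈?_; ⊆-antisym; p⊂q⇒∣p∣<∣q∣)
open import Data.List using (List; []; _∷_; map; foldr; filter; allFin; cartesianProduct)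
open import Data.List.Membership.Propositional.Properties
  using (∈-map⁺; ∈-filter⁺; ∈-cartesianProduct⁺; ∈-allFin)
open import Data.List.Relation.Unary.All as All using (All; []; _∷_)
open import Data.List.Relation.Unary.All.Properties using (all-filter; map⁺)
open import Data.Nat using (ℕ; suc)
open import Data.Nat.Properties using (<⇒≢)
open import Data.Product using (∃; ∃!; ∃₂; _×_; _,_)
open import Data.Sum using (_⊎_; inj₁; inj₂)
open import Function.Base using (_∘_)
open import Function.Bundles using (_⇔_; mk⇔)
import Induction.WellFounded as WF
open import Relation.Binary.PropositionalEquality using (_≡_; refl; sym; trans; subst; subst₂; cong)
open import Relation.Nullary using (¬?)
open import Relation.Nullary.Decidable using (decidable-stable)
open import Relation.Unary using (Pred; _∈_; Decidable)
open import Defs using (Grid; _≈_; IsSudoku; IsSolution; IsDeducibleSolution)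
open import Defs using (Cell; Formula; _≉_; _⇒_; entry; _⊨_; IsFullSudoku; Δax; _⊢_; Prop[_])

private
  variable
    m : ℕ
    Φ : Pred Formula 0ℓ
    α β : Formula

open _⊢_

-- The conclusion of a derivation sits at the last index, so new lines are appended at `fromℕ`,
-- while `inject₁` embeds the old indices without changing their order.
snoc : ∀ {A : Set} → (Fin m → A) → A → Fin (suc m) → A
snoc f a i with view i
... | ‵fromℕ     = a
... | ‵inject₁ j = f j

snoc-fromℕ : ∀ {A : Set} (f : Fin m → A) a → snoc f a (fromℕ m) ≡ a
snoc-fromℕ {m} f a rewrite view-fromℕ m = refl

snoc-inject₁ : ∀ {A : Set} (f : Fin m → A) a i → snoc f a (inject₁ i) ≡ f i
snoc-inject₁ f a i rewrite view-inject₁ i = refl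

inject₁<fromℕ : (i : Fin m) → inject₁ i < fromℕ m
inject₁<fromℕ {m} i rewrite toℕ-inject₁ i | toℕ-fromℕ m = toℕ<n i

inject₁-mono-< : {i j : Fin m} → i < j → inject₁ i < inject₁ j
inject₁-mono-< {i = i} {j} i<j rewrite toℕ-inject₁ i | toℕ-inject₁ j = i<j

-- The axioms stay a variable here: with-abstraction normalises the goal, which
-- would otherwise unfold Δax and all of Σax.
Justified : (Ax Φ : Pred Formula 0ℓ) → (Fin m → Formula) → Pred (Fin m) 0ℓ
Justified Ax Φ f i = f i ∈ Ax ⊎ f i ∈ Φ ⊎ ∃₂ λ p q → p < i × q < i × f q ≡ (f p ⇒ f i)

-- Every old index lies below the new last one, so modus ponens for the new line may cite any two
-- old lines, with no order condition. Old citations survive because `inject₁` is monotone.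
justified-snoc : ∀ {Ax} (f : Fin m → Formula) → (∀ i → Justified Ax Φ f i) →
                 β ∈ Ax ⊎ β ∈ Φ ⊎ ∃₂ (λ p q → f q ≡ (f p ⇒ β)) →
                 ∀ i → Justified Ax Φ (snoc f β) i
justified-snoc {β = β} f f-justified β-justified i with view i
justified-snoc {β = β} f f-justified β-justified _ | ‵fromℕ with β-justified
... | inj₁ ax                    = inj₁ ax
... | inj₂ (inj₁ hyp)            = inj₂ (inj₁ hyp)
... | inj₂ (inj₂ (p , q , q≡p⇒)) = inj₂ (inj₂
  ( inject₁ p , inject₁ q , inject₁<fromℕ p , inject₁<fromℕ q
  , subst₂ (λ x y → x ≡ (y ⇒ β)) (sym (snoc-inject₁ f β q)) (sym (snoc-inject₁ f β p)) q≡p⇒ ))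
justified-snoc {β = β} f f-justified β-justified _ | ‵inject₁ j with f-justified j
... | inj₁ ax                                = inj₁ ax
... | inj₂ (inj₁ hyp)                        = inj₂ (inj₁ hyp)
... | inj₂ (inj₂ (p , q , p<j , q<j , q≡p⇒)) = inj₂ (inj₂
  ( inject₁ p , inject₁ q , inject₁-mono-< p<j , inject₁-mono-< q<j
  , subst₂ (λ x y → x ≡ (y ⇒ f j)) (sym (snoc-inject₁ f β q)) (sym (snoc-inject₁ f β p)) q≡p⇒ ))

-- Both premises of modus ponens have smaller indices, so well-founded induction on the index
-- applies.
justified-induction : ∀ {Ax} (P : Pred Formula 0ℓ) →
                      (∀ {γ} → γ ∈ Ax → P γ) → (∀ {γ} → γ ∈ Φ → P γ) →
                      (∀ {γ δ} → P (γ ⇒ δ) → P γ → P δ) →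
                      (f : Fin m → Formula) → (∀ i → Justified Ax Φ f i) → ∀ i → P (f i)
justified-induction P onAx onHyp onMP f f-justified = wfRec (P ∘ f) step
  where
  open WF.All <-wellFounded 0ℓ using (wfRec)

  step : ∀ i → (∀ {j} → j < i → P (f j)) → P (f i)
  step i rec with f-justified i
  ... | inj₁ ax                                = onAx ax
  ... | inj₂ (inj₁ hyp)                        = onHyp hyp
  ... | inj₂ (inj₂ (p , q , p<i , q<i , q≡p⇒)) = onMP (subst P q≡p⇒ (rec q<i)) (rec p<i)

extend : (D : Φ ⊢ α) → β ∈ Δax ⊎ β ∈ Φ ⊎ ∃₂ (λ p q → φ D q ≡ (φ D p ⇒ β)) → Φ ⊢ β
extend {β = β} D β-justified = record
  { n         = suc (n D)
  ; φ         = snoc (φ D) β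
  ; ends      = snoc-fromℕ (φ D) β
  ; justified = justified-snoc {Ax = Δax} (φ D) (justified D) β-justified
  }

⊢-axiom : α ∈ Δax → Φ ⊢ α
⊢-axiom {α} ax = record
  { n = 0 ; φ = λ _ → α ; ends = refl ; justified = λ _ → inj₁ ax }

⊢-discharge : α ∈ Φ → Φ ⊢ α ⇒ β → Φ ⊢ β
⊢-discharge {α} {β = β} hyp D =
  -- In `D′` the hypothesis `α` is the last line, and the conclusion `α ⇒ β` of `D` comes just
  -- before it.
  extend D′ (inj₂ (inj₂ (fromℕ _ , inject₁ (fromℕ _) , α⇒β)))
  where
  D′ = extend D (inj₂ (inj₁ hyp))

  α⇒β : φ D′ (inject₁ (fromℕ (n D))) ≡ (φ D′ (fromℕ (n D′)) ⇒ β)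
  α⇒β = trans (snoc-inject₁ (φ D) α (fromℕ (n D)))
              (trans (ends D) (cong (_⇒ β) (sym (snoc-fromℕ (φ D) α))))

⊢-discharge-all : ∀ {αs} → All Φ αs → Φ ⊢ foldr _⇒_ β αs → Φ ⊢ β
⊢-discharge-all []           D = D
⊢-discharge-all (hyp ∷ hyps) D = ⊢-discharge-all hyps (⊢-discharge hyp D)

⊨-foldr-⇒ : ∀ {A} αs → (All (A ⊨_) αs → A ⊨ β) → A ⊨ foldr _⇒_ β αs
⊨-foldr-⇒ []       f = f []
⊨-foldr-⇒ (α ∷ αs) f = λ A⊨α → ⊨-foldr-⇒ αs (f ∘ (A⊨α ∷_))

-- `Δax` is defined semantically, so entailment from a finite list packs into one axiom, whose
-- premises are then discharged in turn.
completeness : ∀ {αs} → All Φ αs →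
               (∀ A → IsFullSudoku A → All (A ⊨_) αs → A ⊨ β) → Φ ⊢ β
completeness {αs = αs} hyps entails =
  ⊢-discharge-all hyps (⊢-axiom λ A full → ⊨-foldr-⇒ αs (entails A full))

soundness : ∀ {A} → Φ ⊢ α → IsFullSudoku A → (∀ γ → γ ∈ Φ → A ⊨ γ) → A ⊨ α
soundness {A = A} D full A⊨Φ = subst (A ⊨_) (ends D)
  -- Satisfaction of an implication is a function, so modus ponens is plain application.
  (justified-induction {Ax = Δax} (A ⊨_) (λ ax → ax A full) (A⊨Φ _) (λ A⊨γ⇒δ → A⊨γ⇒δ)
    (φ D) (justified D) (fromℕ (n D)))

toFormula : Cell × Fin 9 → Formula
toFormula (x , d) = x ≉ d

Excluded : Grid → Pred (Cell × Fin 9) 0ℓ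
Excluded A ((i , j) , d) = A ⊨ (i , j) ≉ d

excluded? : ∀ A → Decidable (Excluded A)
excluded? A ((i , j) , d) = ¬? (d ∈? entry A i j)

candidates : List (Cell × Fin 9)
candidates = cartesianProduct (cartesianProduct (allFin 9) (allFin 9)) (allFin 9)

-- A finite listing of `Prop[ A ]`, so that its members can serve as the premises of a single
-- formula.
props : Grid → List Formula
props A = map toFormula (filter (excluded? A) candidates)

props⊆Prop : ∀ A → All Prop[ A ] (props A)
props⊆Prop A = map⁺ (All.map (λ d∉A → _ , _ , _ , d∉A , refl)
                             (all-filter (excluded? A) candidates))

-- If `d` were missing from the cell in `A`, then `props A` would contain the formula forbidding it
-- in `B`. Decidable membership removes the double negation.
⊨props⇒⊆ : ∀ A B → All (B ⊨_) (props A) → ∀ i j → entry B i j ⊆ entry A i j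
⊨props⇒⊆ A B B⊨props i j {d} d∈B =
  decidable-stable (d ∈? entry A i j) λ d∉A → All.lookup B⊨props
    (∈-map⁺ toFormula (∈-filter⁺ (excluded? A)
      (∈-cartesianProduct⁺ (∈-cartesianProduct⁺ (∈-allFin i) (∈-allFin j)) (∈-allFin d))
      d∉A))
    d∈B

⊆⇒⊨Prop : ∀ A B → (∀ i j → entry B i j ⊆ entry A i j) → ∀ γ → γ ∈ Prop[ A ] → B ⊨ γ
⊆⇒⊨Prop _ _ B⊆A _ (i , j , d , d∉A , refl) = d∉A ∘ B⊆A i j

-- An element of `q` outside `p` would make the inclusion strict, hence the cardinalities different.
p⊆q∧∣p∣≡∣q∣⇒p≡q : {p q : Subset m} → p ⊆ q → ∣ p ∣ ≡ ∣ q ∣ → p ≡ q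
p⊆q∧∣p∣≡∣q∣⇒p≡q {p = p} p⊆q ∣p∣≡∣q∣ = ⊆-antisym p⊆q λ {x} x∈q →
  decidable-stable (x ∈? p) λ x∉p → <⇒≢ (p⊂q⇒∣p∣<∣q∣ (p⊆q , x , x∈q , x∉p)) ∣p∣≡∣q∣

unique⇒deducible : ∀ A → ∃! _≈_ (IsSolution A) → ∃ (IsDeducibleSolution A)
unique⇒deducible A (S , S-solves , S-unique) = S , S-solves , deduce
  where
  deduce : ∀ γ → γ ∈ Prop[ S ] → Prop[ A ] ⊢ γ
  deduce _ (i , j , d , d∉S , refl) = completeness (props⊆Prop A)
    λ B full B⊨props →
      -- `B` solves `A`, so uniqueness gives it the entries of `S`, and `d` is absent from it as
      -- well.
      subst (d ∉_) (S-unique {B} (full , ⊨props⇒⊆ A B B⊨props) i j) d∉S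

deducible⇒unique : ∀ A → ∃ (IsDeducibleSolution A) → ∃! _≈_ (IsSolution A)
deducible⇒unique A (S , S-solves@((_ , S-full) , _) , deduce) = S , S-solves , unique
  where
  unique : ∀ {T} → IsSolution A T → S ≈ T
  unique {T} (T-fullSudoku@(_ , T-full) , T⊆A) i j =
    sym (p⊆q∧∣p∣≡∣q∣⇒p≡q T⊆S (trans (T-full i j) (sym (S-full i j))))
    where
    T⊆S : entry T i j ⊆ entry S i j
    T⊆S {d} d∈T = decidable-stable (d ∈? entry S i j) λ d∉S →
      -- The derived exclusion of `d` holds in `T`, because `T` lies inside `A` and so satisfies
      -- `Prop[ A ]`; this contradicts `d∈T`.
      soundness {A = T} (deduce _ (i , j , d , d∉S , refl)) T-fullSudoku
        (⊆⇒⊨Prop A T T⊆A) d∈T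

corollary5p12 : (A : Grid) → IsSudoku A → (∃! _≈_ (IsSolution A)) ⇔ (∃ (IsDeducibleSolution A))
corollary5p12 A _ = mk⇔ (unique⇒deducible A) (deducible⇒unique A)
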